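{- For every sequent $\Gamma\Rightarrow\Delta$: if $\Gamma\Rightarrow\Delta$ is provable in $\mathsf{Grz}_\infty$, then $\mathsf{Grz_{Seq}}\vdash\Gamma\Rightarrow\Delta$.
   Context: Formulas are built from $\bot$ and atomic propositions using $\to$ and $\Box$. A sequent is $\Gamma\Rightarrow\Delta$ with $\Gamma,\Delta$ finite multisets of formulas; $\Box\Pi$ denotes the multiset $\{\Box B:B\in\Pi\}$. Common rules: $(\to_L)$ from $\Gamma,B\Rightarrow\Delta$ and $\Gamma\Rightarrow A,\Delta$ infer $\Gamma,A\to B\Rightarrow\Delta$; $(\to_R)$ from $\Gamma,A\Rightarrow B,\Delta$ infer $\Gamma\Rightarrow A\to B,\Delta$; $(\mathsf{refl})$ from $\Gamma,B,\Box B\Rightarrow\Delta$ infer $\Gamma,\Box B\Rightarrow\Delta$. The finite-proof calculus $\mathsf{Grz_{Seq}}$ has initial sequents $\Gamma,A\Rightarrow A,\Delta$ (any $A$) and $\Gamma,\bot\Rightarrow\Delta$, the rules $(\to_L),(\to_R),(\mathsf{refl})$ and $(\Box_{\mathsf{Grz}})$: from $\Box\Pi,\Box(A\to\Box A)\Rightarrow A$ infer $\Gamma,\Box\Pi\Rightarrow\Box A,\Delta$. The calculus $\mathsf{Grz}_\infty$ has initial sequents $\Gamma,p\Rightarrow p,\Delta$ ($p$ atomic) and $\Gamma,\bot\Rightarrow\Delta$, the rules $(\to_L),(\to_R),(\mathsf{refl})$ and $(\Box)$: from left premise $\Gamma,\Box\Pi\Rightarrow A,\Delta$ and right premise $\Box\Pi\Rightarrow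 A$ infer $\Gamma,\Box\Pi\Rightarrow\Box A,\Delta$. Proofs in $\mathsf{Grz}_\infty$ are $\infty$-proofs: possibly infinite trees of sequents built by these rules, with leaves labelled by initial sequents, in which every infinite branch passes through a right premise of $(\Box)$ infinitely often; a sequent is provable if it labels the root of an $\infty$-proof. -}

module Defs where

open import Data.Fin.Base using (Fin; zero; suc)
open import Data.List.Base using (List; []; _∷_; _++_; map; length; lookup)
open import Data.List.Relation.Binary.Permutation.Propositional using (_↭_)
open import Data.List.Relation.Unary.All using (All)
open import Data.Nat.Base using (ℕ; suc; _≤_)
open import Data.Product.Base using (Σ-syntax; ∃-syntax; _×_; _,_; proj₂)
open import Relation.Binary.PropositionalEquality.Core using (_≡_)

infix  9 □_
infixr 8 _⇾_
infix  4 _⇒_ _≈_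

data Formula : Set where
  ⊥ᶠ   : Formula
  atom : ℕ → Formula
  _⇾_  : Formula → Formula → Formula
  □_   : Formula → Formula

□* : List Formula → List Formula
□* = map □_

-- The two sides of a sequent are finite multisets, represented by lists.
-- A sequent may be inferred by a rule as soon as it is equal to the conclusion
-- of an instance of the rule up to _≈_, so no exchange rule is needed.
record Sequent : Set where
  constructor _⇒_
  field
    antecedent : List Formula
    succedent  : List Formula

_≈_ : Sequent → Sequent → Set
(Γ ⇒ Δ) ≈ (Γ′ ⇒ Δ′) = Γ ↭ Γ′ × Δ ↭ Δ′

-- In each rule relation, the first index lists the premises from left to right
-- and the second one is the conclusion; initial sequents have no premises.
data CommonRule : List Sequent → Sequent → Set where
  ⊥-init : ∀ {Γ Δ} → CommonRule [] (⊥ᶠ ∷ Γ ⇒ Δ)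
  ⇾-L    : ∀ {Γ Δ A B} →
           CommonRule ((B ∷ Γ ⇒ Δ) ∷ (Γ ⇒ A ∷ Δ) ∷ []) (A ⇾ B ∷ Γ ⇒ Δ)
  ⇾-R    : ∀ {Γ Δ A B} →
           CommonRule ((A ∷ Γ ⇒ B ∷ Δ) ∷ []) (Γ ⇒ A ⇾ B ∷ Δ)
  refl-L : ∀ {Γ Δ B} →
           CommonRule ((B ∷ □ B ∷ Γ ⇒ Δ) ∷ []) (□ B ∷ Γ ⇒ Δ)

data SeqRule : List Sequent → Sequent → Set where
  common : ∀ {Ps C} → CommonRule Ps C → SeqRule Ps C
  init   : ∀ {Γ Δ A} → SeqRule [] (A ∷ Γ ⇒ A ∷ Δ)
  □-Grz  : ∀ {Γ Π Δ A} →
           SeqRule ((□ (A ⇾ □ A) ∷ □* Π ⇒ A ∷ []) ∷ []) (Γ ++ □* Π ⇒ □ A ∷ Δ)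

data ∞Rule : List Sequent → Sequent → Set where
  common : ∀ {Ps C} → CommonRule Ps C → ∞Rule Ps C
  init   : ∀ {Γ Δ p} → ∞Rule [] (atom p ∷ Γ ⇒ atom p ∷ Δ)
  □-∞    : ∀ {Γ Π Δ A} →
           ∞Rule ((Γ ++ □* Π ⇒ A ∷ Δ) ∷ (□* Π ⇒ A ∷ []) ∷ []) (Γ ++ □* Π ⇒ □ A ∷ Δ)

infix 3 GrzSeq⊢_ Grz∞⊢_

data GrzSeq⊢_ (S : Sequent) : Set where
  infer : ∀ {Ps C} → S ≈ C → SeqRule Ps C → All GrzSeq⊢_ Ps → GrzSeq⊢ S

-- Possibly infinite trees locally correct with respect to the rules, with no
-- condition on branches yet.
record Tree (S : Sequent) : Set where
  coinductive
  field
    premises   : List Sequent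
    conclusion : Sequent
    matches    : S ≈ conclusion
    rule       : ∞Rule premises conclusion
    subtree    : (i : Fin (length premises)) → Tree (lookup premises i)

open Tree public

Node : Set
Node = Σ[ S ∈ Sequent ] Tree S

Child : Node → Set
Child (_ , t) = Fin (length (premises t))

child : (x : Node) → Child x → Node
child (_ , t) i = lookup (premises t) i , subtree t i

data RightPremise : ∀ {Ps C} → ∞Rule Ps C → Fin (length Ps) → Set where
  right : ∀ {Γ Π Δ A} → RightPremise (□-∞ {Γ} {Π} {Δ} {A}) (suc zero)

record InfiniteBranch {S : Sequent} (t : Tree S) : Set where
  field
    node      : ℕ → Node
    direction : (n : ℕ) → Child (node n)
    start     : node 0 ≡ (S , t)
    next      : (n : ℕ) → node (suc n) ≡ child (node n) (direction n)

  GoesRight : ℕ → Set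
  GoesRight n = RightPremise (rule (proj₂ (node n))) (direction n)

open InfiniteBranch public

Is∞Proof : ∀ {S} → Tree S → Set
Is∞Proof t = (b : InfiniteBranch t) (n : ℕ) → ∃[ m ] n ≤ m × GoesRight b m

Grz∞⊢_ : Sequent → Set
Grz∞⊢ S = Σ[ t ∈ Tree S ] Is∞Proof t

{-# OPTIONS --safe #-}

-- The two calculi are compared through finite tree models.  If a model refutes the
-- conclusion of a rule of Grz∞ at a world, it refutes some premise at the same
-- world, or the right premise of (□) at a strictly higher one; so a refutable
-- root of a tree yields an infinite branch which goes right only finitely
-- often.  Conversely, Grz-Seq is complete for such models: searching for a
-- proof, □ A on the right is reduced to A as soon as □ (A → □ A) is on the left,
-- so that (□Grz) has to be applied only once for each A on a branch.
module Submission where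

open import Data.Empty using (⊥; ⊥-elim)
open import Data.Fin.Base using (Fin; zero; suc)
open import Data.List.Base using (List; []; _∷_; [_]; _++_; concatMap; length; lookup; map)
open import Data.List.Membership.Propositional using (_∈_; find; lose)
open import Data.List.Membership.Propositional.Properties
  using (∈-∃++; ∈-++⁺ˡ; ∈-++⁺ʳ; ∈-++⁻; ∈-map⁺)
open import Data.List.Properties using (++-identityʳ)
open import Data.List.Relation.Binary.Permutation.Propositional
  using (_↭_; ↭-refl; ↭-reflexive; ↭-sym; ↭-trans; prep; swap)
open import Data.List.Relation.Binary.Permutation.Propositional.Properties
  using (All-resp-↭; ∈-resp-↭; ↭-length; shift) renaming (++⁺ˡ to ↭-++⁺ˡ)
open import Data.List.Relation.Unary.All as All using (All; []; _∷_; all?)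
open import Data.List.Relation.Unary.All.Properties
  using (++⁺; ++⁻ˡ; ++⁻ʳ; concat⁻; map⁺; map⁻; ¬All⇒Any¬)
open import Data.List.Relation.Unary.Any using (any?; here; there)
open import Data.Nat.Base using (ℕ; zero; suc; _+_; _≤_; _<_; s≤s)
open import Data.Nat.Properties
  using (_≟_; ≤-refl; ≤-reflexive; ≤-trans; ≤-pred; <⇒≤; <-≤-trans; n≮0; m≤m+n; m≤n+m;
         m≤n⇒m<n∨m≡n)
open import Data.List.Membership.DecPropositional _≟_ using (_∈?_)
open import Data.Product.Base using (Σ-syntax; ∃-syntax; _×_; _,_; proj₁; proj₂)
open import Data.Sum.Base as Sum using (_⊎_; inj₁; inj₂)
open import Data.Unit.Base using (⊤; tt)
open import Function.Base using (_∘_; id)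
open import Relation.Binary.PropositionalEquality using (_≡_; refl; sym; subst; trans)
open import Relation.Nullary using (¬_; Dec; yes; no)
open import Relation.Nullary.Decidable using (_→-dec_)
open import Defs

-- Finite tree models

-- A world is identified with the subtree it generates, so accessibility is the subtree relation:
-- reflexive through `worlds`, strict through `above`.
data Model : Set where
  tree : List ℕ → List Model → Model

valuation : Model → List ℕ
valuation (tree ps _) = ps

above worlds : Model → List Model
worlds* : List Model → List Model
above (tree _ ws) = worlds* ws
worlds w = w ∷ above w
worlds* []       = []
worlds* (w ∷ ws) = worlds w ++ worlds* ws

size : Model → ℕ
size* : List Model → ℕ
size (tree _ ws) = suc (size* ws)
size* []       = 0
size* (w ∷ ws) = size w + size* ws

infix 4 _⊩_ _⊩?_ _⊮*_

_⊩_ : Model → Formula → Set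
w ⊩ ⊥ᶠ     = ⊥
w ⊩ atom p = p ∈ valuation w
w ⊩ A ⇾ B  = w ⊩ A → w ⊩ B
w ⊩ □ A    = All (_⊩ A) (worlds w)

_⊩?_ : ∀ w A → Dec (w ⊩ A)
w ⊩? ⊥ᶠ     = no λ ()
w ⊩? atom p = p ∈? valuation w
w ⊩? A ⇾ B  = (w ⊩? A) →-dec (w ⊩? B)
w ⊩? □ A    = all? (_⊩? A) (worlds w)

worlds-trans : ∀ {u v} w → v ∈ worlds w → u ∈ worlds v → u ∈ worlds w
above-trans : ∀ {u v} w → v ∈ above w → u ∈ worlds v → u ∈ above w
worlds*-trans : ∀ {u v} ws → v ∈ worlds* ws → u ∈ worlds v → u ∈ worlds* ws
worlds-trans w (here refl) u∈ = u∈
worlds-trans w (there v∈)  u∈ = there (above-trans w v∈ u∈)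
above-trans (tree _ ws) = worlds*-trans ws
worlds*-trans (w ∷ ws) v∈ u∈ with ∈-++⁻ (worlds w) v∈
... | inj₁ v∈w  = ∈-++⁺ˡ (worlds-trans w v∈w u∈)
... | inj₂ v∈ws = ∈-++⁺ʳ (worlds w) (worlds*-trans ws v∈ws u∈)

size-worlds : ∀ {v} w → v ∈ worlds w → size v ≤ size w
size-above : ∀ {v} w → v ∈ above w → size v < size w
size-worlds* : ∀ {v} ws → v ∈ worlds* ws → size v ≤ size* ws
size-worlds w (here refl) = ≤-refl
size-worlds w (there v∈)  = <⇒≤ (size-above w v∈)
size-above (tree _ ws) v∈ = s≤s (size-worlds* ws v∈)
size-worlds* (w ∷ ws) v∈ with ∈-++⁻ (worlds w) v∈
... | inj₁ v∈w  = ≤-trans (size-worlds w v∈w) (m≤m+n (size w) _)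
... | inj₂ v∈ws = ≤-trans (size-worlds* ws v∈ws) (m≤n+m _ (size w))

⊩□-mono : ∀ {v} w A → v ∈ worlds w → w ⊩ □ A → v ⊩ □ A
⊩□-mono w A v∈ w⊩ = All.tabulate (All.lookup w⊩ ∘ worlds-trans w v∈)

⊩□*-mono : ∀ {v} w Π → v ∈ worlds w → All (w ⊩_) (□* Π) → All (v ⊩_) (□* Π)
⊩□*-mono w Π v∈ = map⁺ ∘ All.map (λ {A} → ⊩□-mono w A v∈) ∘ map⁻

_⊮*_ : Model → List Formula → Set
w ⊮* Δ = All (λ A → ¬ w ⊩ A) Δ

Refutes : Model → Sequent → Set
Refutes w (Γ ⇒ Δ) = All (w ⊩_) Γ × w ⊮* Δ

-- Soundness of Grz∞

-- `RightPremise` recast by recursion: at every premise other than a right one it reduces to `⊥`, so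
-- `descend` discharges `size-<` there by an absurd pattern.
isRight : ∀ {Ps C} → ∞Rule Ps C → Fin (length Ps) → Set
isRight (common _) _    = ⊥
isRight init       _    = ⊥
isRight □-∞        zero = ⊥
isRight □-∞ (suc zero)  = ⊤

RightPremise⇒isRight : ∀ {Ps C} {r : ∞Rule Ps C} {i} → RightPremise r i → isRight r i
RightPremise⇒isRight right = tt

record Descent (w : Model) {Ps C} (r : ∞Rule Ps C) : Set where
  constructor descent
  field
    premise : Fin (length Ps)
    world   : Model
    refutes : Refutes world (lookup Ps premise)
    size-≤  : size world ≤ size w
    size-<  : isRight r premise → size world < size w

open Descent

descend : ∀ {w Ps C} (r : ∞Rule Ps C) → Refutes w C → Descent w r
descend (common ⊥-init) (() ∷ _ , _)
descend {w} (common (⇾-L {A = A})) (A⇾B ∷ Γ⁺ , Δ⁻) with w ⊩? A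
... | yes A⁺ = descent zero w (A⇾B A⁺ ∷ Γ⁺ , Δ⁻) ≤-refl λ ()
... | no  A⁻ = descent (suc zero) w (Γ⁺ , A⁻ ∷ Δ⁻) ≤-refl λ ()
descend {w} (common (⇾-R {A = A})) (Γ⁺ , ¬A⇾B ∷ Δ⁻) with w ⊩? A
... | yes A⁺ = descent zero w (A⁺ ∷ Γ⁺ , (λ B⁺ → ¬A⇾B (λ _ → B⁺)) ∷ Δ⁻) ≤-refl λ ()
... | no  A⁻ = ⊥-elim (¬A⇾B (⊥-elim ∘ A⁻))
descend {w} (common refl-L) (□B ∷ Γ⁺ , Δ⁻) =
  descent zero w (All.head □B ∷ □B ∷ Γ⁺ , Δ⁻) ≤-refl λ ()
descend init (p⁺ ∷ _ , p⁻ ∷ _) = ⊥-elim (p⁻ p⁺)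
-- If `A` fails at `w` itself, the left premise is refuted with its context intact. If it fails
-- strictly above, only the boxed formulas are carried along, and these are what the right premise
-- keeps.
descend {w} (□-∞ {Γ} {Π} {A = A}) (Γ⁺ , ¬□A ∷ Δ⁻)
  with find (¬All⇒Any¬ (_⊩? A) (worlds w) ¬□A)
... | _ , here refl , A⁻ = descent zero w (Γ⁺ , A⁻ ∷ Δ⁻) ≤-refl λ ()
... | v , there v∈  , A⁻ = descent (suc zero) v
  (⊩□*-mono w Π (there v∈) (++⁻ʳ Γ Γ⁺) , A⁻ ∷ []) (<⇒≤ v<w) λ _ → v<w
  where
  v<w : size v < size w
  v<w = size-above w v∈

State : Set
State = Σ[ x ∈ Node ] Σ[ w ∈ Model ] Refutes w (proj₁ x)

move : ((x , w , _) : State) → Descent w (rule (proj₂ x))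
move ((_ , t) , w , Γ⁺ , Δ⁻) =
  descend (rule t) (All-resp-↭ (proj₁ (matches t)) Γ⁺ , All-resp-↭ (proj₂ (matches t)) Δ⁻)

advance : State → State
advance s@(x , _) = child x (premise d) , world d , refutes d
  where d = move s

iterate : State → ℕ → State
iterate s zero    = s
iterate s (suc n) = advance (iterate s n)

-- Induction on a bound `k` for `h n`: the next index satisfying `P` makes `h` drop below `k`, and
-- `h` never rises in between.
no-infinite-descent : (h : ℕ → ℕ) (P : ℕ → Set) →
  (∀ n → h (suc n) ≤ h n) → (∀ n → P n → h (suc n) < h n) →
  ¬ (∀ n → ∃[ m ] n ≤ m × P m)
no-infinite-descent h P h-≤ h-< often = bounded _ 0 ≤-refl
  where
  anti : ∀ {m} n → m ≤ n → h n ≤ h m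
  anti n m≤n with m≤n⇒m<n∨m≡n m≤n
  anti n       _ | inj₂ refl      = ≤-refl
  anti (suc n) _ | inj₁ (s≤s m≤n) = ≤-trans (h-≤ n) (anti n m≤n)

  bounded : ∀ k n → ¬ h n ≤ k
  bounded k n hn≤k with often n
  ... | m , n≤m , Pm with k | <-≤-trans (h-< m Pm) (≤-trans (anti m n≤m) hn≤k)
  ...   | suc k′ | s≤s h≤k′ = bounded k′ (suc m) h≤k′

∞-sound : ∀ {S} → Grz∞⊢ S → ∀ w → ¬ Refutes w S
∞-sound {S} (t , proof) w w-refutes = no-infinite-descent
  (λ n → size (proj₁ (proj₂ (states n)))) (GoesRight branch)
  (λ n → size-≤ (move (states n)))
  (λ n → size-< (move (states n)) ∘ RightPremise⇒isRight)
  (proof branch)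
  where
  states : ℕ → State
  states = iterate ((S , t) , w , w-refutes)

  branch : InfiniteBranch t
  branch = record
    { node      = λ n → proj₁ (states n)
    ; direction = λ n → premise (move (states n))
    ; start     = refl
    ; next      = λ _ → refl
    }

-- Derived rules of Grz-Seq

∈⇒↭ : ∀ {A : Set} {x : A} {xs} → x ∈ xs → ∃[ ys ] xs ↭ x ∷ ys
∈⇒↭ {x = x} x∈ with ∈-∃++ x∈
... | ys , zs , refl = ys ++ zs , shift x ys zs

shift-into : ∀ {A : Set} {x : A} xs ys {zs} → xs ++ ys ++ x ∷ zs ↭ x ∷ xs ++ ys ++ zs
shift-into {x = x} xs ys {zs} =
  ↭-trans (↭-++⁺ˡ xs (shift x ys zs)) (shift x xs (ys ++ zs))

exchange : ∀ {Γ Γ′ Δ Δ′} → Γ′ ↭ Γ → Δ′ ↭ Δ → GrzSeq⊢ (Γ ⇒ Δ) → GrzSeq⊢ (Γ′ ⇒ Δ′)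
exchange p q (infer (p′ , q′) r ds) = infer (↭-trans p p′ , ↭-trans q q′) r ds

infer₀ : ∀ {S} → SeqRule [] S → GrzSeq⊢ S
infer₀ r = infer (↭-refl , ↭-refl) r []

infer₁ : ∀ {P S} → SeqRule [ P ] S → GrzSeq⊢ P → GrzSeq⊢ S
infer₁ r d = infer (↭-refl , ↭-refl) r (d ∷ [])

infer₂ : ∀ {P Q S} → SeqRule (P ∷ Q ∷ []) S → GrzSeq⊢ P → GrzSeq⊢ Q → GrzSeq⊢ S
infer₂ r d e = infer (↭-refl , ↭-refl) r (d ∷ e ∷ [])

-- Initial sequents and `□-Grz` absorb `D` into the arbitrary context of their conclusion; the other
-- rules hand it up to their premises.
weakenR : ∀ {Γ Δ} D → GrzSeq⊢ (Γ ⇒ Δ) → GrzSeq⊢ (Γ ⇒ D ∷ Δ)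
weakenR D (infer (p , q) (common ⊥-init) []) =
  infer (p , ↭-refl) (common ⊥-init) []
weakenR D (infer (p , q) (common ⇾-L) (d ∷ e ∷ [])) =
  infer (p , prep D q) (common ⇾-L)
    (weakenR D d ∷ exchange ↭-refl (swap _ D ↭-refl) (weakenR D e) ∷ [])
weakenR D (infer (p , q) (common ⇾-R) (d ∷ [])) =
  infer (p , ↭-trans (prep D q) (swap D _ ↭-refl)) (common ⇾-R)
    (exchange ↭-refl (swap _ D ↭-refl) (weakenR D d) ∷ [])
weakenR D (infer (p , q) (common refl-L) (d ∷ [])) =
  infer (p , prep D q) (common refl-L) (weakenR D d ∷ [])
weakenR D (infer (p , q) init []) =
  infer (p , ↭-trans (prep D q) (swap D _ ↭-refl)) init []
weakenR D (infer (p , q) □-Grz ds) =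
  infer (p , ↭-trans (prep D q) (swap D _ ↭-refl)) □-Grz ds

init-∈ : ∀ {A Γ Δ} → A ∈ Γ → A ∈ Δ → GrzSeq⊢ (Γ ⇒ Δ)
init-∈ A∈Γ A∈Δ = exchange (proj₂ (∈⇒↭ A∈Γ)) (proj₂ (∈⇒↭ A∈Δ)) (infer₀ init)

refl-∈ : ∀ {B Γ Δ} → □ B ∈ Γ → GrzSeq⊢ (B ∷ Γ ⇒ Δ) → GrzSeq⊢ (Γ ⇒ Δ)
refl-∈ {B} □B∈ d with ∈⇒↭ □B∈
... | _ , p = exchange p ↭-refl
  (infer₁ (common refl-L) (exchange (prep B (↭-sym p)) ↭-refl d))

refl-All : ∀ {Γ Δ} Σ → All (λ B → □ B ∈ Γ) Σ → GrzSeq⊢ (Σ ++ Γ ⇒ Δ) → GrzSeq⊢ (Γ ⇒ Δ)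
refl-All []      []          d = d
refl-All (B ∷ Σ) (□B∈ ∷ □Σ∈) d = refl-All Σ □Σ∈ (refl-∈ (∈-++⁺ʳ Σ □B∈) d)

-- Reflexivity releases `A ⇾ □ A`. Splitting it leaves an initial sequent with `□ A` on both sides,
-- and the given derivation weakened by `□ A`.
diagonal-∈ : ∀ {A Γ Δ} → □ (A ⇾ □ A) ∈ Γ → GrzSeq⊢ (Γ ⇒ A ∷ Δ) → GrzSeq⊢ (Γ ⇒ □ A ∷ Δ)
diagonal-∈ {A} □C∈ d = refl-∈ □C∈ (infer₂ (common ⇾-L)
  (infer₀ init)
  (exchange ↭-refl (swap A (□ A) ↭-refl) (weakenR (□ A) d)))

-- Completeness of Grz-Seq

-- boxes⁺ A lists the B such that □ B can get to the right when A stands on the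
-- right, boxes⁻ A those when A stands on the left.  In boxes⁺ (□ A) the part
-- boxes⁻ A is due to the formula A ⇾ □ A which (□Grz) puts on the left.
boxes⁺ boxes⁻ : Formula → List Formula
boxes⁺ ⊥ᶠ       = []
boxes⁺ (atom _) = []
boxes⁺ (A ⇾ B)  = boxes⁻ A ++ boxes⁺ B
boxes⁺ (□ A)    = A ∷ boxes⁺ A ++ boxes⁻ A
boxes⁻ ⊥ᶠ       = []
boxes⁻ (atom _) = []
boxes⁻ (A ⇾ B)  = boxes⁺ A ++ boxes⁻ B
boxes⁻ (□ A)    = boxes⁻ A

-- `U` is a fixed finite stock containing every `A` whose box can reach the right during the search;
-- its finiteness bounds the uses of `□-Grz` on a branch.
module _ (U : List Formula) where

  Pos Neg : Formula → Set
  Pos A = All (_∈ U) (boxes⁺ A)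
  Neg A = All (_∈ U) (boxes⁻ A)

  -- The part of a sequent already decomposed by the search.  L lists the A to
  -- whose box (□Grz) may still be applied.
  record Context (L : List Formula) : Set where
    field
      leftBoxes  : List Formula
      leftAtoms  : List ℕ
      rightAtoms : List ℕ
      rightBoxes : List Formula
      leftBoxes-neg  : All Neg leftBoxes
      rightBoxes-pos : All (λ A → A ∈ L × Pos (□ A)) rightBoxes
      available      : ∀ {A} → A ∈ U → A ∈ L ⊎ A ⇾ □ A ∈ leftBoxes

    leftSide rightSide : List Formula
    leftSide  = map atom leftAtoms ++ □* leftBoxes
    rightSide = map atom rightAtoms ++ □* rightBoxes

  open Context

  -- A stored left box speaks only of the worlds above the root: its truth at the root comes from
  -- the unboxed copy that is decomposed separately.
  record Countermodel {L} (c : Context L) (Γ Δ : List Formula) : Set where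
    constructor countermodel
    field
      root       : Model
      Γ-true     : All (root ⊩_) Γ
      Δ-false    : root ⊮* Δ
      leftAtoms-true   : All (_∈ valuation root) (leftAtoms c)
      rightAtoms-false : All (λ p → ¬ p ∈ valuation root) (rightAtoms c)
      leftBoxes-above  : All (λ B → All (_⊩ B) (above root)) (leftBoxes c)
      rightBoxes-false : All (λ A → ¬ root ⊩ □ A) (rightBoxes c)

  -- Quantifying over contexts puts the search in continuation-passing style: a solver for the
  -- remaining formulas is called on a context enlarged by the atoms and boxes found so far.
  Solvable : List Formula → List Formula → List Formula → Set
  Solvable L Γ Δ = (c : Context L) →
    GrzSeq⊢ (Γ ++ leftSide c ⇒ Δ ++ rightSide c) ⊎ Countermodel c Γ Δ

  -- Decomposing formulas into a context

  addLeftAtom addRightAtom : ∀ {L} → ℕ → Context L → Context L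
  addLeftAtom  p c = record c { leftAtoms = p ∷ leftAtoms c }
  addRightAtom p c = record c { rightAtoms = p ∷ rightAtoms c }

  addLeftBox : ∀ {L} A → Neg A → Context L → Context L
  addLeftBox A A-neg c = record c
    { leftBoxes     = A ∷ leftBoxes c
    ; leftBoxes-neg = A-neg ∷ leftBoxes-neg c
    ; available     = Sum.map₂ there ∘ available c
    }

  addRightBox : ∀ {L} A → A ∈ L → Pos (□ A) → Context L → Context L
  addRightBox A A∈L □A-pos c = record c
    { rightBoxes     = A ∷ rightBoxes c
    ; rightBoxes-pos = (A∈L , □A-pos) ∷ rightBoxes-pos c
    }

  -- Structural recursion on the formula being added. Every step is invertible, in that a
  -- countermodel to any premise yields one to the conclusion, so there is no backtracking.
  addL : ∀ {L Γ Δ} A → Neg A → Solvable L Γ Δ → Solvable L (A ∷ Γ) Δ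
  addR : ∀ {L Γ Δ} A → Pos A → Solvable L Γ Δ → Solvable L Γ (A ∷ Δ)

  addL ⊥ᶠ _ _ _ = inj₁ (infer₀ (common ⊥-init))
  addL {Γ = Γ} (atom p) _ solve c with solve (addLeftAtom p c)
  ... | inj₁ d = inj₁ (exchange (↭-sym (shift (atom p) Γ (leftSide c))) ↭-refl d)
  ... | inj₂ (countermodel w Γ⁺ Δ⁻ (p⁺ ∷ P⁺) Q⁻ Σ⁺ Θ⁻) =
    inj₂ (countermodel w (p⁺ ∷ Γ⁺) Δ⁻ P⁺ Q⁻ Σ⁺ Θ⁻)
  addL (A ⇾ B) neg solve c
    with addL B (++⁻ʳ (boxes⁺ A) neg) solve c | addR A (++⁻ˡ (boxes⁺ A) neg) solve c
  ... | inj₁ d | inj₁ e = inj₁ (infer₂ (common ⇾-L) d e)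
  ... | inj₂ (countermodel w (B⁺ ∷ Γ⁺) Δ⁻ P⁺ Q⁻ Σ⁺ Θ⁻) | _ =
    inj₂ (countermodel w ((λ _ → B⁺) ∷ Γ⁺) Δ⁻ P⁺ Q⁻ Σ⁺ Θ⁻)
  ... | inj₁ _ | inj₂ (countermodel w Γ⁺ (A⁻ ∷ Δ⁻) P⁺ Q⁻ Σ⁺ Θ⁻) =
    inj₂ (countermodel w ((⊥-elim ∘ A⁻) ∷ Γ⁺) Δ⁻ P⁺ Q⁻ Σ⁺ Θ⁻)
  addL {Γ = Γ} (□ A) neg solve c with addL A neg solve (addLeftBox A neg c)
  ... | inj₁ d = inj₁ (infer₁ (common refl-L)
    (exchange (prep A (↭-sym (shift-into Γ (map atom (leftAtoms c))))) ↭-refl d))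
  ... | inj₂ (countermodel w (A⁺ ∷ Γ⁺) Δ⁻ P⁺ Q⁻ (A-above ∷ Σ⁺) Θ⁻) =
    inj₂ (countermodel w ((A⁺ ∷ A-above) ∷ Γ⁺) Δ⁻ P⁺ Q⁻ Σ⁺ Θ⁻)

  addR ⊥ᶠ _ solve c with solve c
  ... | inj₁ d = inj₁ (weakenR ⊥ᶠ d)
  ... | inj₂ (countermodel w Γ⁺ Δ⁻ P⁺ Q⁻ Σ⁺ Θ⁻) =
    inj₂ (countermodel w Γ⁺ (id ∷ Δ⁻) P⁺ Q⁻ Σ⁺ Θ⁻)
  addR {Δ = Δ} (atom p) _ solve c with solve (addRightAtom p c)
  ... | inj₁ d = inj₁ (exchange ↭-refl (↭-sym (shift (atom p) Δ (rightSide c))) d)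
  ... | inj₂ (countermodel w Γ⁺ Δ⁻ P⁺ (p⁻ ∷ Q⁻) Σ⁺ Θ⁻) =
    inj₂ (countermodel w Γ⁺ (p⁻ ∷ Δ⁻) P⁺ Q⁻ Σ⁺ Θ⁻)
  addR (A ⇾ B) pos solve c
    with addL A (++⁻ˡ (boxes⁻ A) pos) (addR B (++⁻ʳ (boxes⁻ A) pos) solve) c
  ... | inj₁ d = inj₁ (infer₁ (common ⇾-R) d)
  ... | inj₂ (countermodel w (A⁺ ∷ Γ⁺) (B⁻ ∷ Δ⁻) P⁺ Q⁻ Σ⁺ Θ⁻) =
    inj₂ (countermodel w Γ⁺ ((λ A⇾B → B⁻ (A⇾B A⁺)) ∷ Δ⁻) P⁺ Q⁻ Σ⁺ Θ⁻)
  addR {Δ = Δ} (□ A) pos@(A∈U ∷ _) solve c with available c A∈U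
  ... | inj₁ A∈L with solve (addRightBox A A∈L pos c)
  ...   | inj₁ d = inj₁ (exchange ↭-refl
    (↭-sym (shift-into Δ (map atom (rightAtoms c)))) d)
  ...   | inj₂ (countermodel w Γ⁺ Δ⁻ P⁺ Q⁻ Σ⁺ (A⁻ ∷ Θ⁻)) =
    inj₂ (countermodel w Γ⁺ (A⁻ ∷ Δ⁻) P⁺ Q⁻ Σ⁺ Θ⁻)
  -- Here `□ (A ⇾ □ A)` is already on the left, so `□ A` reduces to `A`; conversely, refuting `A` at
  -- the root refutes `□ A` by reflexivity.
  addR {Γ = Γ} (□ A) (_ ∷ A-pos,neg) solve c | inj₂ C∈
    with addR A (++⁻ˡ (boxes⁺ A) A-pos,neg) solve c
  ... | inj₁ d = inj₁ (diagonal-∈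
    (∈-++⁺ʳ Γ (∈-++⁺ʳ (map atom (leftAtoms c)) (∈-map⁺ □_ C∈))) d)
  ... | inj₂ (countermodel w Γ⁺ (A⁻ ∷ Δ⁻) P⁺ Q⁻ Σ⁺ Θ⁻) =
    inj₂ (countermodel w Γ⁺ ((A⁻ ∘ All.head) ∷ Δ⁻) P⁺ Q⁻ Σ⁺ Θ⁻)

  addL* : ∀ {L Γ Δ} Γ′ → All Neg Γ′ → Solvable L Γ Δ → Solvable L (Γ′ ++ Γ) Δ
  addL* []       []           solve = solve
  addL* (A ∷ Γ′) (neg ∷ negs) solve = addL A neg (addL* Γ′ negs solve)

  addR* : ∀ {L Γ Δ} Δ′ → All Pos Δ′ → Solvable L Γ Δ → Solvable L Γ (Δ′ ++ Δ)
  addR* []       []           solve = solve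
  addR* (A ∷ Δ′) (pos ∷ poss) solve = addR A pos (addR* Δ′ poss solve)

  -- The modal step and the gluing of countermodels

  BoxSolution : List Formula → Formula → Set
  BoxSolution Σ A =
    GrzSeq⊢ (□ (A ⇾ □ A) ∷ □* Σ ⇒ [ A ]) ⊎
    (∃[ w ] All (λ B → w ⊩ □ B) Σ × ¬ w ⊩ A)

  -- Applying `□-Grz` to `A` takes one occurrence of `A` out of `L` and puts `A ⇾ □ A` among the
  -- left boxes, so `available` is preserved while `L` shrinks. The formulas of `Σ` enter both
  -- boxed, in `c′`, and unboxed, to be decomposed; `refl-All` absorbs the unboxed copies.
  boxSolution : ∀ {L} → (∀ {L′} → length L′ < length L → Solvable L′ [] []) →
    (c : Context L) → ∀ {A} → A ∈ L → Pos (□ A) → BoxSolution (leftBoxes c) A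
  boxSolution {L} solve c {A} A∈L (_ ∷ A-pos,neg) =
    result (addL* Σ negs (addR* [ A ] (A-pos ∷ []) (solve L′<L)) c′)
    where
    L′ : List Formula
    L′ = proj₁ (∈⇒↭ A∈L)
    L↭ : L ↭ A ∷ L′
    L↭ = proj₂ (∈⇒↭ A∈L)
    L′<L : length L′ < length L
    L′<L = ≤-reflexive (sym (↭-length L↭))

    Σ : List Formula
    Σ = A ⇾ □ A ∷ leftBoxes c

    A-pos : Pos A
    A-pos = ++⁻ˡ (boxes⁺ A) A-pos,neg

    negs : All Neg Σ
    -- `boxes⁻ (A ⇾ □ A)` unfolds to `boxes⁺ A ++ boxes⁻ A`, the tail of `boxes⁺ (□ A)`.
    negs = A-pos,neg ∷ leftBoxes-neg c

    available′ : ∀ {B} → B ∈ U → B ∈ L′ ⊎ B ⇾ □ B ∈ Σ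
    available′ B∈U with available c B∈U
    ... | inj₂ C∈ = inj₂ (there C∈)
    ... | inj₁ B∈L with ∈-resp-↭ L↭ B∈L
    ...   | here refl  = inj₂ (here refl)
    ...   | there B∈L′ = inj₁ B∈L′

    c′ : Context L′
    c′ = record
      { leftAtoms = [] ; leftBoxes = Σ ; rightAtoms = [] ; rightBoxes = []
      ; leftBoxes-neg = negs ; rightBoxes-pos = [] ; available = available′ }

    result : GrzSeq⊢ ((Σ ++ []) ++ □* Σ ⇒ [ A ]) ⊎ Countermodel c′ (Σ ++ []) [ A ] →
      BoxSolution (leftBoxes c) A
    result (inj₁ d) = inj₁ (refl-All Σ (All.tabulate (∈-map⁺ □_))
      (subst (λ Γ → GrzSeq⊢ (Γ ++ □* Σ ⇒ [ A ])) (++-identityʳ Σ) d))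
    result (inj₂ (countermodel w (_ ∷ Σ⁺) (A⁻ ∷ []) _ _ (_ ∷ Σ-above) _)) =
      inj₂ (w , All.zipWith (λ (B⁺ , B-above) → B⁺ ∷ B-above)
        (++⁻ˡ (leftBoxes c) Σ⁺ , Σ-above) , A⁻)

  -- One derivable premise suffices for `□-Grz`. Failing that, there is a countermodel for each
  -- right box, and together they become the immediate successors of a new root.
  collect : ∀ {Σ} Θ → All (BoxSolution Σ) Θ →
    (∃[ A ] A ∈ Θ × GrzSeq⊢ (□ (A ⇾ □ A) ∷ □* Σ ⇒ [ A ])) ⊎
    (∃[ ws ] All (λ B → All (_⊩ B) (worlds* ws)) Σ ×
            All (λ A → ¬ All (_⊩ A) (worlds* ws)) Θ)
  collect [] [] = inj₂ ([] , All.tabulate (λ _ → []) , [])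
  collect (A ∷ Θ) (inj₁ d ∷ _) = inj₁ (A , here refl , d)
  collect (A ∷ Θ) (inj₂ (w , Σ⁺ , A⁻) ∷ sols) with collect Θ sols
  ... | inj₁ (B , B∈ , d) = inj₁ (B , there B∈ , d)
  ... | inj₂ (ws , Σ⁺* , Θ⁻) = inj₂
    ( w ∷ ws
    , All.zipWith (λ (B⁺ , B⁺*) → ++⁺ B⁺ B⁺*) (Σ⁺ , Σ⁺*)
    , (A⁻ ∘ All.head) ∷ All.map (λ B⁻ → B⁻ ∘ ++⁻ʳ (worlds w)) Θ⁻ )

  -- The bound `n` serves as fuel for the mutual recursion: each application of `□-Grz` lowers it,
  -- because `L` gets shorter.
  solveContext : ∀ n {L} → length L ≤ n → Solvable L [] []
  solveSmaller : ∀ n {L L′} → length L ≤ n → length L′ < length L → Solvable L′ [] []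
  solveSmaller zero    L≤n L′<L = ⊥-elim (n≮0 (<-≤-trans L′<L L≤n))
  solveSmaller (suc n) L≤n L′<L = solveContext n (≤-pred (<-≤-trans L′<L L≤n))
  solveContext n {L} L≤n c with any? (_∈? rightAtoms c) (leftAtoms c)
  ... | yes clash with find clash
  ...   | p , p∈P , p∈Q = inj₁ (init-∈ (∈-++⁺ˡ (∈-map⁺ atom p∈P)) (∈-++⁺ˡ (∈-map⁺ atom p∈Q)))
  solveContext n {L} L≤n c | no ¬clash
    with collect (rightBoxes c)
      (All.map (λ (A∈L , □A-pos) → boxSolution (solveSmaller n {L} L≤n) c A∈L □A-pos)
        (rightBoxes-pos c))
  ... | inj₁ (A , A∈Θ , d) = inj₁ (exchange ↭-refl (proj₂ (∈⇒↭ □A∈))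
    (infer₁ □-Grz d))
    where
    □A∈ : □ A ∈ rightSide c
    □A∈ = ∈-++⁺ʳ (map atom (rightAtoms c)) (∈-map⁺ □_ A∈Θ)
  -- The new root makes exactly the left atoms true; without a clash the right atoms are then false.
  -- Each right box already fails in some successor tree.
  ... | inj₂ (ws , Σ⁺ , Θ⁻) = inj₂ (countermodel (tree (leftAtoms c) ws) [] []
    (All.tabulate id)
    (All.tabulate λ q∈Q q∈P → ¬clash (lose q∈P q∈Q))
    Σ⁺
    (All.map (λ A⁻ → A⁻ ∘ All.tail) Θ⁻))

complete : ∀ Γ Δ → GrzSeq⊢ (Γ ⇒ Δ) ⊎ (∃[ w ] Refutes w (Γ ⇒ Δ))
complete Γ Δ = Sum.map
  (exchange (unit Γ) (unit Δ))
  (λ (countermodel w Γ⁺ Δ⁻ _ _ _ _) → w , ++⁻ˡ Γ Γ⁺ , ++⁻ˡ Δ Δ⁻)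
  (addL* U Γ negs (addR* U Δ poss (solveContext U (length U) ≤-refl)) empty)
  where
  U : List Formula
  -- All candidates that the end sequent can produce; the search starts with `L = U`, so each of
  -- them is available.
  U = concatMap boxes⁻ Γ ++ concatMap boxes⁺ Δ

  negs : All (Neg U) Γ
  negs = map⁻ (concat⁻ (++⁻ˡ (concatMap boxes⁻ Γ) (All.tabulate id)))

  poss : All (Pos U) Δ
  poss = map⁻ (concat⁻ (++⁻ʳ (concatMap boxes⁻ Γ) (All.tabulate id)))

  empty : Context U U
  empty = record
    { leftAtoms = [] ; leftBoxes = [] ; rightAtoms = [] ; rightBoxes = []
    ; leftBoxes-neg = [] ; rightBoxes-pos = [] ; available = inj₁ }

  unit : ∀ Ξ → Ξ ↭ (Ξ ++ []) ++ []
  unit Ξ = ↭-reflexive (sym (trans (++-identityʳ (Ξ ++ [])) (++-identityʳ Ξ)))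

theorem3p6 : (Γ Δ : List Formula) → Grz∞⊢ (Γ ⇒ Δ) → GrzSeq⊢ (Γ ⇒ Δ)
theorem3p6 Γ Δ proof with complete Γ Δ
... | inj₁ d = d
... | inj₂ (w , w-refutes) = ⊥-elim (∞-sound proof w w-refutes)
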